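{- Let $k\geq 2$ and let $G=G_1\square G_2 \square \cdots \square G_k$ be a Cartesian prime factorization of $G$ into mutually non-isomorphic connected graphs. For $i=1,\ldots,k$ let $Q_i=G_1\square\cdots\square G_{i-1}\square G_{i+1}\square\cdots\square G_k$, so $|Q_i|=|G|/|G_i|$. Then $$\theta (G)=\max \left\{ \left(\theta(G_i)-1\right)\cdot |Q_i|\; : \; i=1,\dots,k \right\}+1.$$
   Context: Graphs are finite and simple; $|H|$ denotes the number of vertices of $H$. A vertex coloring of a graph is distinguishing if the identity is the only automorphism preserving it (mapping every vertex to a vertex of the same color). The distinguishing threshold $\theta(H)$ of a graph $H$ is the minimum number $t$ such that for every $k\geq t$, every vertex coloring of $H$ using $k$ colors is distinguishing. The Cartesian product $G\square H$ has vertex set $V(G)\times V(H)$, with $(g,h)\sim(g',h')$ iff either $g=g'$ and $hh'\in E(H)$, or $gg'\in E(G)$ and $h=h'$; a graph is prime (with respect to the Cartesian product) if it is not isomorphic to a Cartesian product of two graphs both non-isomorphic to it. -}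

module Defs where

open import Data.Fin.Base using (Fin; zero; suc; finToFun; funToFin)
import Data.Fin.Properties as Fin
open import Data.Nat.Base using (ℕ; zero; suc; _*_; _≤_; z≤n; s≤s)
import Data.Nat.Properties as ℕ
open import Data.Product.Base using (∃; ∃₂; _×_; _,_; proj₁; proj₂)
open import Data.Product.Function.NonDependent.Propositional using (_×-↔_)
open import Data.Sum.Base using (_⊎_; inj₁; inj₂)
open import Data.Vec.Functional using (Vector; head; tail)
open import Function.Base using (_∘_)
open import Function.Bundles using (_↔_; _⇔_; Inverse; Injection; Equivalence; mk↔ₛ′; mk⇔)
open import Function.Construct.Composition using (_↔-∘_)
open import Function.Construct.Symmetry using (↔-sym)
open import Function.Definitions using (StrictlySurjective)
open import Function.Properties.Inverse using (↔⇒↣)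
open import Relation.Binary.Construct.Closure.ReflexiveTransitive using (Star)
open import Relation.Binary.PropositionalEquality
  using (_≡_; _≗_; refl; sym; trans; cong; subst; subst₂)
open import Relation.Nullary using (Dec; yes; no; ¬_; contradiction)
open import Relation.Nullary.Decidable using (map′; _×-dec_; _⊎-dec_; _→-dec_; via-injection)

record Graph : Set₁ where
  field
    V      : Set
    order  : ℕ
    enum   : V ↔ Fin order
    E      : V → V → Set
    E?     : ∀ u v → Dec (E u v)
    E-sym  : ∀ {u v} → E u v → E v u
    E-irr  : ∀ {v} → ¬ E v v

  _≟_ : (u v : V) → Dec (u ≡ v)
  _≟_ = via-injection (↔⇒↣ enum) Fin._≟_

open Graph public using (V; E)

∣_∣ : Graph → ℕ
∣ H ∣ = Graph.order H

infix 4 _≅_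

record _≅_ (G H : Graph) : Set where
  field
    bij   : V G ↔ V H
    edges : ∀ u v → E G u v ⇔ E H (Inverse.to bij u) (Inverse.to bij v)

  to : V G → V H
  to = Inverse.to bij

  from : V H → V G
  from = Inverse.from bij

Connected : Graph → Set
Connected H = V H × (∀ u v → Star (E H) u v)

infixr 6 _□_

_□_ : Graph → Graph → Graph
G □ H = record
  { V     = V G × V H
  ; order = ∣ G ∣ * ∣ H ∣
  ; enum  = ↔-sym Fin.*↔× ↔-∘ (G.enum ×-↔ H.enum)
  ; E     = λ (g , h) (g′ , h′) → (g ≡ g′ × E H h h′) ⊎ (E G g g′ × h ≡ h′)
  ; E?    = λ (g , h) (g′ , h′) →
              ((g G.≟ g′) ×-dec H.E? h h′) ⊎-dec (G.E? g g′ ×-dec (h H.≟ h′))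
  ; E-sym = λ { (inj₁ (p , e)) → inj₁ (sym p , H.E-sym e)
              ; (inj₂ (e , p)) → inj₂ (G.E-sym e , sym p) }
  ; E-irr = λ { (inj₁ (_ , e)) → H.E-irr e
              ; (inj₂ (e , _)) → G.E-irr e }
  }
  where
  module G = Graph G
  module H = Graph H

∏ : ∀ {n} → Vector Graph (suc n) → Graph
∏ {zero}  F = head F
∏ {suc n} F = head F □ ∏ (tail F)

IsPrime : Graph → Set₁
IsPrime H = ¬ (∃₂ λ A B → ¬ (A ≅ H) × ¬ (B ≅ H) × H ≅ A □ B)

Distinguishing : (H : Graph) {k : ℕ} → (V H → Fin k) → Set
Distinguishing H c =
  (φ : H ≅ H) → (∀ v → c (_≅_.to φ v) ≡ c v) → ∀ v → _≅_.to φ v ≡ v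

-- A coloring "using k colors" uses every one of the k colors.
AllDistinguishing : Graph → ℕ → Set
AllDistinguishing H k =
  (c : V H → Fin k) → StrictlySurjective _≡_ c → Distinguishing H c

-- Numbers of colors are positive: a nonempty graph has no coloring with
-- 0 colors, so admitting t = 0 would give asymmetric graphs the threshold
-- 0 instead of the intended 1.
record IsThreshold (H : Graph) (t : ℕ) : Set where
  field
    positive : 1 ≤ t
    bound    : ∀ k → t ≤ k → AllDistinguishing H k
    minimal  : ∀ s → 1 ≤ s → (∀ k → s ≤ k → AllDistinguishing H k) → t ≤ s

-- AllDistinguishing H k is decidable, and it
-- holds vacuously for k > ∣ H ∣, so the threshold is found by searching
-- downwards from suc ∣ H ∣.

private

  all→? : ∀ {A B : Set} {m n} → A ↔ Fin m → B ↔ Fin n → {P : (A → B) → Set} →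
          (∀ {f g} → f ≗ g → P f → P g) → (∀ f → Dec (P f)) → Dec (∀ f → P f)
  all→? {A} {B} {m} {n} α β {P} resp P? =
    map′ (λ p f → resp (decode-encode f) (p (encode f))) (λ p i → p (decode i))
         (Fin.all? (P? ∘ decode))
    where
    module α = Inverse α
    module β = Inverse β
    decode : Fin _ → A → B
    decode i a = β.from (finToFun {n} {m} i (α.to a))
    encode : (A → B) → Fin _
    encode f = funToFin (β.to ∘ f ∘ α.from)
    decode-encode : ∀ f → decode (encode f) ≗ f
    decode-encode f a = trans
      (cong β.from (Fin.finToFun-funToFin (β.to ∘ f ∘ α.from) (α.to a)))
      (trans (β.strictlyInverseʳ _) (cong f (α.strictlyInverseʳ a)))

  module _ {A : Set} {m} (α : A ↔ Fin m) {P : A → Set} (P? : ∀ a → Dec (P a)) where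
    module α = Inverse α

    all∈? : Dec (∀ a → P a)
    all∈? = map′ (λ p a → subst P (α.strictlyInverseʳ a) (p (α.to a)))
                 (λ p i → p (α.from i)) (Fin.all? (P? ∘ α.from))

    any∈? : Dec (∃ P)
    any∈? = map′ (λ (i , p) → α.from i , p)
                 (λ (a , p) → α.to a , subst P (sym (α.strictlyInverseʳ a)) p)
                 (Fin.any? (P? ∘ α.from))

  _⇔-dec_ : ∀ {A B : Set} → Dec A → Dec B → Dec (A ⇔ B)
  A? ⇔-dec B? = map′ (λ (f , g) → mk⇔ f g)
    (λ e → Equivalence.to e , Equivalence.from e) ((A? →-dec B?) ×-dec (B? →-dec A?))

  module _ (H : Graph) where
    open Graph H using (order; enum; E?; _≟_)

    IsAut : (f g : V H → V H) → Set
    IsAut f g = (∀ v → f (g v) ≡ v) × (∀ v → g (f v) ≡ v) ×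
                (∀ u v → E H u v ⇔ E H (f u) (f v))

    isAut? : ∀ f g → Dec (IsAut f g)
    isAut? f g = all∈? enum (λ v → f (g v) ≟ v) ×-dec all∈? enum (λ v → g (f v) ≟ v)
      ×-dec all∈? enum (λ u → all∈? enum (λ v → E? u v ⇔-dec E? (f u) (f v)))

    isAut-resp : ∀ {f f′ g g′} → f ≗ f′ → g ≗ g′ → IsAut f g → IsAut f′ g′
    isAut-resp {f} {f′} {g} {g′} p q (a , b , e) =
      (λ v → trans (sym (trans (cong f (q v)) (p (g′ v)))) (a v)) ,
      (λ v → trans (sym (trans (cong g (p v)) (q (f′ v)))) (b v)) ,
      (λ u v → subst₂ (λ x y → E H u v ⇔ E H x y) (p u) (p v) (e u v))

    Rigid : ∀ {k} → (V H → Fin k) → (f g : V H → V H) → Set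
    Rigid c f g = IsAut f g → (∀ v → c (f v) ≡ c v) → ∀ v → f v ≡ v

    rigid-resp : ∀ {k} {c : V H → Fin k} {f f′ g g′} → f ≗ f′ → g ≗ g′ →
                 Rigid c f g → Rigid c f′ g′
    rigid-resp {c = c} p q r a h v = trans (sym (p v))
      (r (isAut-resp (sym ∘ p) (sym ∘ q) a) (λ w → trans (cong c (p w)) (h w)) v)

    rigid? : ∀ {k} (c : V H → Fin k) f g → Dec (Rigid c f g)
    rigid? c f g = isAut? f g →-dec (all∈? enum (λ v → c (f v) Fin.≟ c v)
      →-dec all∈? enum (λ v → f v ≟ v))

    distinguishing? : ∀ {k} (c : V H → Fin k) → Dec (Distinguishing H c)
    distinguishing? c = map′
      (λ r φ → r (_≅_.to φ) (_≅_.from φ)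
        ( Inverse.strictlyInverseˡ (_≅_.bij φ)
        , Inverse.strictlyInverseʳ (_≅_.bij φ)
        , _≅_.edges φ))
      (λ d f g (a , b , e) → d (record { bij = mk↔ₛ′ f g a b ; edges = e }))
      (all→? enum enum (λ p r g → rigid-resp p (λ _ → refl) (r g))
        (λ f → all→? enum enum (λ q → rigid-resp {f = f} (λ _ → refl) q)
          (rigid? c f)))

    allDistinguishing? : ∀ k → Dec (AllDistinguishing H k)
    allDistinguishing? k = all→? enum (mk↔ₛ′ (λ i → i) (λ i → i) (λ _ → refl) (λ _ → refl))
      (λ {c} {c′} p d s φ h → d
        (λ y → proj₁ (s y) , trans (p _) (proj₂ (s y))) φ
        (λ v → trans (p _) (trans (h v) (sym (p v)))))
      (λ c → Fin.all? (λ y → any∈? enum (λ x → c x Fin.≟ y)) →-dec distinguishing? c)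

    vacuous : ∀ k → suc order ≤ k → AllDistinguishing H k
    vacuous k order<k c s = contradiction order<k (ℕ.≤⇒≯ (Fin.injective⇒≤ {f = f} f-inj))
      where
      f : Fin k → Fin order
      f y = Inverse.to enum (proj₁ (s y))
      f-inj : ∀ {x y} → f x ≡ f y → x ≡ y
      f-inj {x} {y} eq = trans (sym (proj₂ (s x)))
        (trans (cong c (Injection.injective (↔⇒↣ enum) eq)) (proj₂ (s y)))

    search : ∀ t → (∀ k → suc t ≤ k → AllDistinguishing H k) → ∃ (IsThreshold H)
    search zero    b = 1 , record { positive = s≤s z≤n ; bound = b ; minimal = λ _ 1≤s _ → 1≤s }
    search (suc t) b with allDistinguishing? (suc t)
    ... | no ¬d = suc (suc t) , record
      { positive = s≤s z≤n
      ; bound    = b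
      ; minimal  = λ s _ b′ → ℕ.≰⇒> (λ s≤1+t → ¬d (b′ (suc t) s≤1+t))
      }
    ... | yes d = search t b′
      where
      b′ : ∀ k → suc t ≤ k → AllDistinguishing H k
      b′ k 1+t≤k with suc t ℕ.≟ k
      ... | yes refl  = d
      ... | no 1+t≢k  = b k (ℕ.≤∧≢⇒< 1+t≤k 1+t≢k)

threshold : ∀ H → ∃ (IsThreshold H)
threshold H = search H (Graph.order H) (vacuous H)

θ : Graph → ℕ
θ H = proj₁ (threshold H)

{-# OPTIONS --safe #-}
module Submission where

-- An automorphism ψ of G acts coordinatewise. As G_i is prime, ψ sends a
-- layer of G_i, which is geodesically closed, into a layer of a single factor
-- G_j; applying the same to ψ⁻¹ gives G_i ≅ G_j and so i = j. Hence changing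
-- one coordinate of v changes only that coordinate of ψ v.
--
-- For "≥", a non-distinguishing colouring c of G_i with θ(G_i) - 1 colours
-- gives the non-distinguishing colouring v ↦ (c v_i, remaining coordinates).
-- For "≤", if a colouring with k > (θ(G_i) - 1) |Q_i| colours is preserved by
-- ψ, then colour each vertex a of G_i by the set of colours occurring over a.
-- Each such set has at most |Q_i| elements, so at least θ(G_i) sets occur, and
-- the i-th component of ψ, preserving this colouring, is the identity.

open import Defs
open import Data.Fin.Base using (Fin; zero; suc; punchIn; combine; remQuot)
import Data.Fin.Properties as Fin
open import Data.Nat.Base using (ℕ; zero; suc; _+_; _*_; _∸_; _⊔_; _≤_; _<_; z≤n; s≤s)
open import Data.Nat.Induction using (<-wellFounded)
import Data.Nat.Properties as ℕ
open import Data.Nat.Tactic.RingSolver using (solve-∀)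
open import Data.Product.Base using (∃; ∃₂; _×_; _,_; proj₁; proj₂)
open import Data.Sum.Base using (_⊎_; inj₁; inj₂)
open import Data.Vec.Functional using (Vector; foldr; head; tail; removeAt)
open import Function.Base using (_∘_; id)
open import Function.Bundles using (Inverse; Equivalence; mk↔ₛ′; mk⇔)
open import Function.Construct.Identity using (↔-id)
open import Function.Definitions using (StrictlySurjective)
open import Induction.WellFounded using (Acc; acc)
open import Level using (0ℓ)
open import Relation.Binary.Construct.Closure.ReflexiveTransitive using (Star; ε; _◅_; _◅◅_; gmap)
import Relation.Binary.Construct.On as On
open import Relation.Binary.Core using (Rel)
open import Relation.Binary.PropositionalEquality
  using (_≡_; _≢_; refl; sym; trans; cong; cong₂; subst; subst₂; module ≡-Reasoning)
open import Relation.Binary.Structures using (IsDecEquivalence)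
open import Relation.Nullary using (Dec; yes; no; ¬_; contradiction)
open import Relation.Nullary.Decidable using (_×-dec_; _→-dec_)

private
  variable
    A B C D X Y Z : Graph

-- Isomorphisms and products

E-resp : ∀ X {u u′ v v′} → u ≡ u′ → v ≡ v′ → E X u v → E X u′ v′
E-resp X = subst₂ (E X)

module Iso {X Y : Graph} (φ : X ≅ Y) where
  open _≅_ φ public using (to; from)

  to-from : ∀ y → to (from y) ≡ y
  to-from = Inverse.strictlyInverseˡ (_≅_.bij φ)

  from-to : ∀ x → from (to x) ≡ x
  from-to = Inverse.strictlyInverseʳ (_≅_.bij φ)

  to-edge : ∀ {u v} → E X u v → E Y (to u) (to v)
  to-edge = Equivalence.to (_≅_.edges φ _ _)

  from-edge : ∀ {u v} → E Y u v → E X (from u) (from v)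
  from-edge e = Equivalence.from (_≅_.edges φ _ _)
    (E-resp Y (sym (to-from _)) (sym (to-from _)) e)

  to-injective : ∀ {u v} → to u ≡ to v → u ≡ v
  to-injective eq = trans (sym (from-to _)) (trans (cong from eq) (from-to _))

mk≅ : (f : V X → V Y) (g : V Y → V X) →
      (∀ y → f (g y) ≡ y) → (∀ x → g (f x) ≡ x) →
      (∀ {u v} → E X u v → E Y (f u) (f v)) →
      (∀ {u v} → E Y u v → E X (g u) (g v)) → X ≅ Y
mk≅ {X} f g fg gf f-edge g-edge = record
  { bij   = mk↔ₛ′ f g fg gf
  ; edges = λ u v → mk⇔ f-edge (λ e → E-resp X (gf u) (gf v) (g-edge e))
  }

≅-refl : X ≅ X
≅-refl = mk≅ (λ x → x) (λ x → x) (λ _ → refl) (λ _ → refl) (λ e → e) (λ e → e)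

≅-sym : X ≅ Y → Y ≅ X
≅-sym φ = mk≅ from to from-to to-from from-edge to-edge
  where open Iso φ

≅-trans : X ≅ Y → Y ≅ Z → X ≅ Z
≅-trans φ ψ = mk≅ (ψ.to ∘ φ.to) (φ.from ∘ ψ.from)
  (λ z → trans (cong ψ.to (φ.to-from _)) (ψ.to-from z))
  (λ x → trans (cong φ.from (ψ.from-to _)) (φ.from-to x))
  (ψ.to-edge ∘ φ.to-edge) (φ.from-edge ∘ ψ.from-edge)
  where
  module φ = Iso φ
  module ψ = Iso ψ

□-comm : A □ B ≅ B □ A
□-comm = mk≅ (λ (a , b) → b , a) (λ (b , a) → a , b) (λ _ → refl) (λ _ → refl)
  (λ { (inj₁ (p , e)) → inj₂ (e , p) ; (inj₂ (e , p)) → inj₁ (p , e) })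
  (λ { (inj₁ (p , e)) → inj₂ (e , p) ; (inj₂ (e , p)) → inj₁ (p , e) })

□-exchange : A □ (B □ C) ≅ B □ (A □ C)
□-exchange {A} {B} {C} = mk≅ (λ (a , b , c) → b , a , c) (λ (b , a , c) → a , b , c)
  (λ _ → refl) (λ _ → refl) (edge A B) (edge B A)
  where
  edge : ∀ A B {u v : V (A □ (B □ C))} → E (A □ (B □ C)) u v →
         E (B □ (A □ C)) (proj₁ (proj₂ u) , proj₁ u , proj₂ (proj₂ u))
                         (proj₁ (proj₂ v) , proj₁ v , proj₂ (proj₂ v))
  edge A B (inj₁ (p , inj₁ (q , e))) = inj₁ (q , inj₁ (p , e))
  edge A B (inj₁ (p , inj₂ (e , q))) = inj₂ (e , cong₂ _,_ p q)
  edge A B (inj₂ (e , refl))         = inj₁ (refl , inj₂ (e , refl))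

□-congʳ : B ≅ C → A □ B ≅ A □ C
□-congʳ φ = mk≅ (λ (a , b) → a , to b) (λ (a , c) → a , from c)
  (λ (a , c) → cong (a ,_) (to-from c)) (λ (a , b) → cong (a ,_) (from-to b))
  (λ { (inj₁ (p , e)) → inj₁ (p , to-edge e) ; (inj₂ (e , p)) → inj₂ (e , cong to p) })
  (λ { (inj₁ (p , e)) → inj₁ (p , from-edge e) ; (inj₂ (e , p)) → inj₂ (e , cong from p) })
  where open Iso φ

□-connected : Connected A → Connected B → Connected (A □ B)
□-connected (a₀ , walkA) (b₀ , walkB) = (a₀ , b₀) , λ (a , b) (a′ , b′) →
  gmap (_, b) (λ e → inj₂ (e , refl)) (walkA a a′) ◅◅
  gmap (a′ ,_) (λ e → inj₁ (refl , e)) (walkB b b′)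

∏-connected : ∀ {n} (F : Vector Graph (suc n)) → (∀ i → Connected (F i)) → Connected (∏ F)
∏-connected {zero}  F con = con zero
∏-connected {suc n} F con = □-connected {head F} {∏ (tail F)} (con zero)
  (∏-connected (tail F) (con ∘ suc))

-- Moving one factor to the front leaves only products of two graphs to consider. In the image,
-- `proj₁` is coordinate `i` and `proj₂` collects all the others.
isolate : ∀ {n} (F : Vector Graph (2 + n)) i → ∏ F ≅ F i □ ∏ (removeAt F i)
isolate         F zero       = ≅-refl
isolate {zero}  F (suc zero) = □-comm
isolate {suc n} F (suc i)    = ≅-trans (□-congʳ (isolate (tail F) i)) □-exchange

isolate-ext : ∀ {n} (F : Vector Graph (2 + n)) {v w} →
  (∀ i → proj₁ (_≅_.to (isolate F i) v) ≡ proj₁ (_≅_.to (isolate F i) w)) → v ≡ w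
isolate-ext {zero}  F eq = cong₂ _,_ (eq zero) (eq (suc zero))
isolate-ext {suc n} F eq = cong₂ _,_ (eq zero) (isolate-ext (tail F) (eq ∘ suc))

-- For `i ≢ j` coordinate `i` is kept in `removeAt F j`, so it can be read off from the part outside
-- coordinate `j`.
isolate-indep : ∀ {n} (F : Vector Graph (2 + n)) {i j} → i ≢ j → ∀ {v w} →
  proj₂ (_≅_.to (isolate F j) v) ≡ proj₂ (_≅_.to (isolate F j) w) →
  proj₁ (_≅_.to (isolate F i) v) ≡ proj₁ (_≅_.to (isolate F i) w)
isolate-indep         F {zero}     {zero}     i≢j eq = contradiction refl i≢j
isolate-indep {zero}  F {suc zero} {zero}     i≢j eq = eq
isolate-indep {suc n} F {suc i}    {zero}     i≢j eq =
  cong (proj₁ ∘ _≅_.to (isolate (tail F) i)) eq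
isolate-indep {zero}  F {zero}     {suc zero} i≢j eq = eq
isolate-indep {suc n} F {zero}     {suc j}    i≢j eq = cong proj₁ eq
isolate-indep {zero}  F {suc zero} {suc zero} i≢j eq = contradiction refl i≢j
isolate-indep {suc n} F {suc i}    {suc j}    i≢j eq =
  isolate-indep (tail F) (i≢j ∘ cong suc) (cong proj₂ eq)

-- Images of layers

-- The length is an index because `layer-box` argues by descent on it, in place of shortest walks.
data Walk (X : Graph) : ℕ → V X → V X → Set where
  []  : ∀ {u} → Walk X 0 u u
  _∷_ : ∀ {n u v w} → E X u v → Walk X n v w → Walk X (suc n) u w

infixr 5 _∷_ _++_

_++_ : ∀ {m n u v w} → Walk X m u v → Walk X n v w → Walk X (m + n) u w
[]      ++ q = q
(e ∷ p) ++ q = e ∷ (p ++ q)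

mapWalk : (f : V X → V Y) → (∀ {u v} → E X u v → E Y (f u) (f v)) →
          ∀ {n u v} → Walk X n u v → Walk Y n (f u) (f v)
mapWalk f f-edge []      = []
mapWalk f f-edge (e ∷ p) = f-edge e ∷ mapWalk f f-edge p

Walk₀⇒≡ : ∀ {u v} → Walk X 0 u v → u ≡ v
Walk₀⇒≡ [] = refl

fromStar : ∀ {u v} → Star (E X) u v → ∃ λ n → Walk X n u v
fromStar ε       = 0 , []
fromStar (e ◅ s) with n , p ← fromStar s = suc n , e ∷ p

-- An edge of the product moves exactly one of the two coordinates, so it is charged to exactly one
-- of the two walks.
unzip : ∀ {n a a′ b b′} → Walk (A □ B) n (a , b) (a′ , b′) →
        ∃₂ λ k l → k + l ≡ n × Walk A k a a′ × Walk B l b b′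
unzip [] = 0 , 0 , refl , [] , []
unzip (inj₁ (refl , e) ∷ w) with k , l , eq , p , q ← unzip w =
  k , suc l , trans (ℕ.+-suc k l) (cong suc eq) , p , e ∷ q
unzip (inj₂ (e , refl) ∷ w) with k , l , eq , p , q ← unzip w =
  suc k , l , cong suc eq , e ∷ p , q

-- A walk between two vertices of φ(A × b) can be rearranged to pass through
-- any prescribed corner. If the corner is outside φ(A × b), then the pulled
-- back walk makes steps in B; erasing them shortens it.
layer-box : Connected A → (φ : A □ B ≅ C □ D) → ∀ b x x′ →
  ∃ λ y → _≅_.to φ (y , b) ≡ (proj₁ (_≅_.to φ (x , b)) , proj₂ (_≅_.to φ (x′ , b)))
layer-box {A} {B} {C} {D} (_ , con) φ b x x′ =
  let n , w = fromStar (con x x′) in go (<-wellFounded n) (lift w)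
  where
  open Iso φ
  f : V A → V (C □ D)
  f a = to (a , b)

  lift : ∀ {n u v} → Walk A n u v → Walk (C □ D) n (f u) (f v)
  lift = mapWalk f (λ e → to-edge (inj₂ (e , refl)))

  corner : V (C □ D)
  corner = proj₁ (f x) , proj₂ (f x′)

  lower : ∀ {n u v} → Walk (C □ D) n u v → Walk (A □ B) n (from u) (from v)
  lower = mapWalk from from-edge

  go : ∀ {n} → Acc _<_ n → Walk (C □ D) n (f x) (f x′) → ∃ λ y → f y ≡ corner
  go {n} (acc rec) w
    with k , l , k+l≡n , p , q ← unzip w
    with k₁ , l₁ , eq₁ , p₁ , q₁ ← unzip
      (subst (λ v → Walk (A □ B) l v (from corner)) (from-to (x , b))
        (lower (mapWalk (proj₁ (f x) ,_) (λ e → inj₁ (refl , e)) q)))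
    with k₂ , l₂ , eq₂ , p₂ , q₂ ← unzip
      (subst (Walk (A □ B) k (from corner)) (from-to (x′ , b))
        (lower (mapWalk (_, proj₂ (f x′)) (λ e → inj₂ (e , refl)) p)))
    -- Testing the half from `(x , b)` to `from corner` is enough: without a step in `B` it ends
    -- over `b`, so `corner` is a value of `f`.
    with l₁
  ... | zero = proj₁ (from corner) ,
    trans (cong (λ d → to (proj₁ (from corner) , d)) (Walk₀⇒≡ q₁)) (to-from corner)
  ... | suc l₁ = go (rec shorter) (lift (p₁ ++ p₂))
    where
    shorter : k₁ + k₂ < n
    shorter = subst (k₁ + k₂ <_)
      (trans (ℕ.+-comm (k₁ + suc l₁) _) (trans (cong₂ _+_ eq₂ eq₁) k+l≡n))
      (ℕ.≤-trans (s≤s (ℕ.m≤m+n (k₁ + k₂) (l₁ + l₂)))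
        (ℕ.≤-reflexive (lemma k₁ k₂ l₁ l₂)))
      where
      lemma : ∀ a b c d → suc (a + b + (c + d)) ≡ a + suc c + (b + d)
      lemma = solve-∀

-- Decidable subsets and induced subgraphs.

-- A finite subset as a list without repetitions. Its elements are numbered by `Fin size` and not
-- taken from `∃ P`, where different proofs of `P x` would count as different elements.
record Selection {S : Set} (P : S → Set) : Set where
  field
    size         : ℕ
    select       : Fin size → S
    sound        : ∀ i → P (select i)
    injective    : ∀ {i j} → select i ≡ select j → i ≡ j
    index        : ∀ {x} → P x → Fin size
    select-index : ∀ {x} (p : P x) → select (index p) ≡ x

selectFin : ∀ {n} {P : Fin n → Set} → (∀ i → Dec (P i)) → Selection P
selectFin {zero} P? = record
  { size = 0 ; select = λ () ; sound = λ () ; injective = λ { {()} }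
  ; index = λ { {()} } ; select-index = λ { {()} } }
selectFin {suc n} {P} P? with P? zero | selectFin (P? ∘ suc)
... | no ¬p | S = record
  { size         = size
  ; select       = suc ∘ select
  ; sound        = sound
  ; injective    = injective ∘ Fin.suc-injective
  ; index        = λ { {zero} p → contradiction p ¬p ; {suc i} p → index p }
  ; select-index = λ { {zero} p → contradiction p ¬p ; {suc i} p → cong suc (select-index p) }
  }
  where open Selection S
... | yes p₀ | S = record
  { size         = suc size
  ; select       = λ { zero → zero ; (suc i) → suc (select i) }
  ; sound        = λ { zero → p₀ ; (suc i) → sound i }
  ; injective    = λ { {zero} {zero} _ → refl
                     ; {suc i} {suc j} eq → cong suc (injective (Fin.suc-injective eq)) }
  ; index        = λ { {zero} p → zero ; {suc i} p → suc (index p) }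
  ; select-index = λ { {zero} p → refl ; {suc i} p → cong suc (select-index p) }
  }
  where open Selection S

selectV : ∀ X {P : V X → Set} → (∀ v → Dec (P v)) → Selection P
selectV X {P} P? = record
  { size         = size
  ; select       = from ∘ select
  ; sound        = sound
  ; injective    = λ eq → injective
      (trans (sym (strictlyInverseˡ _)) (trans (cong to eq) (strictlyInverseˡ _)))
  ; index        = index ∘ back
  ; select-index = λ p → trans (cong from (select-index (back p))) (strictlyInverseʳ _)
  }
  where
  open Inverse (Graph.enum X)
  open Selection (selectFin (P? ∘ from))
  back : ∀ {v} → P v → P (from (to v))
  back = subst P (sym (strictlyInverseʳ _))

all-or-exception : ∀ X {P : V X → Set} → (∀ v → Dec (P v)) → (∀ v → P v) ⊎ ∃ λ v → ¬ P v
all-or-exception X {P} P? with Fin.all? (P? ∘ Inverse.from (Graph.enum X))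
... | yes p = inj₁ λ v → subst P (Inverse.strictlyInverseʳ (Graph.enum X) v) (p _)
... | no ¬p with i , ¬q ← Fin.¬∀⟶∃¬ _ _ (P? ∘ Inverse.from (Graph.enum X)) ¬p = inj₂ (_ , ¬q)

induced : ∀ X {P : V X → Set} → Selection P → Graph
induced X S = record
  { V     = Fin size
  ; order = size
  ; enum  = ↔-id _
  ; E     = λ i j → E X (select i) (select j)
  ; E?    = λ i j → Graph.E? X (select i) (select j)
  ; E-sym = Graph.E-sym X
  ; E-irr = Graph.E-irr X
  }
  where open Selection S

-- Pigeonhole: adding `x` to the selected vertices gives `suc size` distinct vertices of `X`, which
-- an isomorphism would inject into `Fin size`.
proper⇒≇ : ∀ X {P : V X → Set} (S : Selection P) {x} → ¬ P x → ¬ (induced X S ≅ X)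
proper⇒≇ X {P} S {x} ¬px φ = Fin.<⇒notInjective {f = from ∘ extended} ℕ.≤-refl
  (extended-injective ∘ Iso.to-injective (≅-sym φ))
  where
  open Selection S
  open Iso φ using (from)
  extended : Fin (suc size) → V X
  extended zero    = x
  extended (suc i) = select i
  extended-injective : ∀ {i j} → extended i ≡ extended j → i ≡ j
  extended-injective {zero}  {zero}  _  = refl
  extended-injective {zero}  {suc j} eq = contradiction (subst P (sym eq) (sound j)) ¬px
  extended-injective {suc i} {zero}  eq = contradiction (subst P eq (sound i)) ¬px
  extended-injective {suc i} {suc j} eq = cong suc (injective eq)

-- A is the product of the two slices {proj₂ ∘ f = const} and {proj₁ ∘ f = const}
-- through x₀.
module _ {A C D : Graph} (f : V A → V (C □ D))
  (f-injective : ∀ {x y} → f x ≡ f y → x ≡ y)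
  (f-edge : ∀ {x y} → E A x y → E (C □ D) (f x) (f y))
  (f-edge⁻ : ∀ {x y} → E (C □ D) (f x) (f y) → E A x y)
  (box : ∀ x y → ∃ λ z → f z ≡ (proj₁ (f x) , proj₂ (f y)))
  (x₀ : V A)
  where

  private
    corner : V A → V A → V A
    corner x y = proj₁ (box x y)

    f-corner : ∀ x y → f (corner x y) ≡ (proj₁ (f x) , proj₂ (f y))
    f-corner x y = proj₂ (box x y)

    InU InW : V A → Set
    InU x = proj₂ (f x) ≡ proj₂ (f x₀)
    InW x = proj₁ (f x) ≡ proj₁ (f x₀)

    InU? : ∀ x → Dec (InU x)
    InU? x = Graph._≟_ D _ _

    InW? : ∀ x → Dec (InW x)
    InW? x = Graph._≟_ C _ _

    SU : Selection InU
    SU = selectV A InU?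

    SW : Selection InW
    SW = selectV A InW?

    module SU = Selection SU
    module SW = Selection SW

    inU : ∀ x → InU (corner x x₀)
    inU x = cong proj₂ (f-corner x x₀)

    inW : ∀ x → InW (corner x₀ x)
    inW x = cong proj₁ (f-corner x₀ x)

  box-decomposition : A ≅ induced A SU □ induced A SW
  box-decomposition = mk≅ split join split-join join-split split-edge join-edge
    where
    split : V A → Fin SU.size × Fin SW.size
    split x = SU.index (inU x) , SW.index (inW x)

    join : Fin SU.size × Fin SW.size → V A
    join (i , j) = corner (SU.select i) (SW.select j)

    select-split₁ : ∀ x → f (SU.select (proj₁ (split x))) ≡ (proj₁ (f x) , proj₂ (f x₀))
    select-split₁ x = trans (cong f (SU.select-index (inU x))) (f-corner x x₀)

    select-split₂ : ∀ x → f (SW.select (proj₂ (split x))) ≡ (proj₁ (f x₀) , proj₂ (f x))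
    select-split₂ x = trans (cong f (SW.select-index (inW x))) (f-corner x₀ x)

    f-join : ∀ i j → f (join (i , j)) ≡ (proj₁ (f (SU.select i)) , proj₂ (f (SW.select j)))
    f-join i j = f-corner _ _

    join-split : ∀ x → join (split x) ≡ x
    join-split x = f-injective (trans (f-join _ _)
      (cong₂ _,_ (cong proj₁ (select-split₁ x)) (cong proj₂ (select-split₂ x))))

    split-join : ∀ y → split (join y) ≡ y
    split-join (i , j) = cong₂ _,_
      (SU.injective (f-injective (trans (select-split₁ _)
        (cong₂ _,_ (cong proj₁ (f-join i j)) (sym (SU.sound i))))))
      (SW.injective (f-injective (trans (select-split₂ _)
        (cong₂ _,_ (sym (SW.sound j)) (cong proj₂ (f-join i j))))))

    split-edge : ∀ {x y} → E A x y → E (induced A SU □ induced A SW) (split x) (split y)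
    split-edge {x} {y} e with f-edge e
    ... | inj₁ (p , d) = inj₁
      ( SU.injective (f-injective (trans (select-split₁ x)
          (trans (cong (_, proj₂ (f x₀)) p) (sym (select-split₁ y)))))
      , f-edge⁻ (E-resp (C □ D) (sym (select-split₂ x)) (sym (select-split₂ y))
          (inj₁ (refl , d))))
    ... | inj₂ (c , p) = inj₂
      ( f-edge⁻ (E-resp (C □ D) (sym (select-split₁ x)) (sym (select-split₁ y))
          (inj₂ (c , refl)))
      , SW.injective (f-injective (trans (select-split₂ x)
          (trans (cong (proj₁ (f x₀) ,_) p) (sym (select-split₂ y))))))

    -- On each slice one coordinate of `f` is constant. An image edge moving that coordinate would
    -- be a loop, so it moves the other one.
    coherentD : ∀ {i j} → E A (SW.select i) (SW.select j) →
                E D (proj₂ (f (SW.select i))) (proj₂ (f (SW.select j)))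
    coherentD e with f-edge e
    ... | inj₁ (_ , d) = d
    ... | inj₂ (c , _) = contradiction
      (E-resp C (SW.sound _) (SW.sound _) c) (Graph.E-irr C)

    coherentC : ∀ {i j} → E A (SU.select i) (SU.select j) →
                E C (proj₁ (f (SU.select i))) (proj₁ (f (SU.select j)))
    coherentC e with f-edge e
    ... | inj₂ (c , _) = c
    ... | inj₁ (_ , d) = contradiction
      (E-resp D (SU.sound _) (SU.sound _) d) (Graph.E-irr D)

    join-edge : ∀ {u v} → E (induced A SU □ induced A SW) u v → E A (join u) (join v)
    join-edge (inj₁ (refl , e)) = f-edge⁻
      (E-resp (C □ D) (sym (f-join _ _)) (sym (f-join _ _)) (inj₁ (refl , coherentD e)))
    join-edge (inj₂ (e , refl)) = f-edge⁻
      (E-resp (C □ D) (sym (f-join _ _)) (sym (f-join _ _)) (inj₂ (coherentC e , refl)))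

  -- If neither coordinate of `f` were constant, each slice would miss a vertex. By `proper⇒≇`
  -- neither would be isomorphic to `A`, and `box-decomposition` would contradict primality.
  prime-box : IsPrime A → (∀ x → proj₁ (f x) ≡ proj₁ (f x₀)) ⊎ (∀ x → proj₂ (f x) ≡ proj₂ (f x₀))
  prime-box prime with all-or-exception A InW? | all-or-exception A InU?
  ... | inj₁ c | _      = inj₁ c
  ... | inj₂ _ | inj₁ d = inj₂ d
  ... | inj₂ (_ , ¬w) | inj₂ (_ , ¬u) = contradiction
    (induced A SU , induced A SW , proper⇒≇ A SU ¬u , proper⇒≇ A SW ¬w , box-decomposition)
    prime

-- Layers of a prime factor under isomorphisms of products.

-- The layer over `b` is an induced copy of `A`, since `B` has no loops, and `layer-box` makes its
-- image a box; so `prime-box` applies.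
layer-dichotomy : IsPrime A → Connected A → (φ : A □ B ≅ C □ D) → ∀ b x₀ →
  (∀ x → proj₁ (_≅_.to φ (x , b)) ≡ proj₁ (_≅_.to φ (x₀ , b))) ⊎
  (∀ x → proj₂ (_≅_.to φ (x , b)) ≡ proj₂ (_≅_.to φ (x₀ , b)))
layer-dichotomy {A} {B} {C} {D} prime con φ b x₀ = prime-box
  {A} {C} {D} (λ x → to (x , b)) (cong proj₁ ∘ to-injective)
  (λ e → to-edge (inj₂ (e , refl)))
  (λ e → reflect (Equivalence.from (_≅_.edges φ _ _) e))
  (layer-box con φ b) x₀ prime
  where
  open Iso φ
  reflect : ∀ {x y} → E (A □ B) (x , b) (y , b) → E A x y
  reflect (inj₁ (_ , e)) = contradiction e (Graph.E-irr B)
  reflect (inj₂ (e , _)) = e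

-- `φ` and its inverse restrict to mutually inverse maps between the layers over `b` and over `d`.
-- The image of an edge cannot move the `D`-coordinate, which stays at `d`.
layer-iso : (φ : A □ B ≅ C □ D) → ∀ b d →
  (∀ x → proj₂ (_≅_.to φ (x , b)) ≡ d) →
  (∀ y → proj₂ (_≅_.from φ (y , d)) ≡ b) → A ≅ C
layer-iso {A} {B} {C} {D} φ b d b→d d→b = mk≅
  (λ x → proj₁ (to (x , b))) (λ y → proj₁ (from (y , d)))
  (inverse (≅-sym φ) d→b b→d) (inverse φ b→d d→b)
  (edge φ b→d) (edge (≅-sym φ) d→b)
  where
  open Iso φ using (to; from)
  inverse : ∀ {A B C D : Graph} {b d} (φ : A □ B ≅ C □ D) →
    (∀ x → proj₂ (_≅_.to φ (x , b)) ≡ d) → (∀ y → proj₂ (_≅_.from φ (y , d)) ≡ b) →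
    ∀ x → proj₁ (_≅_.from φ (proj₁ (_≅_.to φ (x , b)) , d)) ≡ x
  inverse φ b→d d→b x = cong proj₁
    (trans (cong (_≅_.from φ) (cong (_ ,_) (sym (b→d x)))) (Iso.from-to φ _))
  edge : ∀ {A B C D : Graph} {b d} (φ : A □ B ≅ C □ D) →
    (∀ x → proj₂ (_≅_.to φ (x , b)) ≡ d) →
    ∀ {x y} → E A x y → E C (proj₁ (_≅_.to φ (x , b))) (proj₁ (_≅_.to φ (y , b)))
  edge {D = D} φ b→d e with Iso.to-edge φ (inj₂ (e , refl))
  ... | inj₁ (_ , e′) = contradiction (E-resp D (b→d _) (b→d _) e′) (Graph.E-irr D)
  ... | inj₂ (e′ , _) = e′
-- Automorphisms of products of primes

-- All the ways of splitting off one factor, side by side. `ext` and `indep` record how these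
-- splittings fit together, so that the nested pairs of `∏` can be forgotten.
record Coordinates {n} (X : Graph) (F Q : Vector Graph n) : Set where
  field
    σ : ∀ i → X ≅ F i □ Q i

  coord : ∀ i → V X → V (F i)
  coord i v = proj₁ (_≅_.to (σ i) v)

  rest : ∀ i → V X → V (Q i)
  rest i v = proj₂ (_≅_.to (σ i) v)

  field
    ext   : ∀ {v w} → (∀ i → coord i v ≡ coord i w) → v ≡ w
    indep : ∀ {i j} → i ≢ j → ∀ {v w} → rest j v ≡ rest j w → coord i v ≡ coord i w

  place : ∀ i → V (F i) → V (Q i) → V X
  place i a q = _≅_.from (σ i) (a , q)

  coord-place : ∀ i a q → coord i (place i a q) ≡ a
  coord-place i a q = cong proj₁ (Iso.to-from (σ i) (a , q))

  rest-place : ∀ i a q → rest i (place i a q) ≡ q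
  rest-place i a q = cong proj₂ (Iso.to-from (σ i) (a , q))

  place-coord : ∀ i {v q} → rest i v ≡ q → place i (coord i v) q ≡ v
  place-coord i refl = Iso.from-to (σ i) _

  -- By `ext` an edge changes some coordinate `j`, as there are no loops; in `F j □ Q j` it then
  -- fixes the other component.
  edge⇒rest≡ : ∀ {v w} → E X v w → ∃ λ j → rest j v ≡ rest j w
  edge⇒rest≡ {v} {w} e with Fin.all? (λ i → Graph._≟_ (F i) (coord i v) (coord i w))
  ... | yes eq = contradiction (E-resp X (ext eq) refl e) (Graph.E-irr X)
  ... | no ¬eq with j , vⱼ≢wⱼ ← Fin.¬∀⟶∃¬ n _ (λ i → Graph._≟_ (F i) _ _) ¬eq
    with Iso.to-edge (σ j) e
  ...   | inj₁ (vⱼ≡wⱼ , _) = contradiction vⱼ≡wⱼ vⱼ≢wⱼ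
  ...   | inj₂ (_ , eq)    = j , eq

module Automorphisms {n} {X : Graph} {F Q : Vector Graph n} (coords : Coordinates X F Q)
  (prime : ∀ i → IsPrime (F i)) (F-connected : ∀ i → Connected (F i))
  (Q-connected : ∀ i → Connected (Q i)) (distinct : ∀ i j → i ≢ j → ¬ (F i ≅ F j))
  where
  open Coordinates coords

  private
    transfer : X ≅ X → ∀ i j → F i □ Q i ≅ F j □ Q j
    transfer ψ i j = ≅-trans (≅-sym (σ i)) (≅-trans ψ (σ j))

  -- The layer of factor `i` through `v` consists of the `w` with `rest i w ≡ rest i v`;
  -- `layer-dichotomy` is restated in these terms.
  layer-image : ∀ (ψ : X ≅ X) i j v →
    (∀ w → rest i w ≡ rest i v → coord j (_≅_.to ψ w) ≡ coord j (_≅_.to ψ v)) ⊎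
    (∀ w → rest i w ≡ rest i v → rest j (_≅_.to ψ w) ≡ rest j (_≅_.to ψ v))
  layer-image ψ i j v
    with layer-dichotomy (prime i) (F-connected i) (transfer ψ i j) (rest i v) (coord i v)
  ... | inj₁ eq = inj₁ λ w p → trans (cong (coord j ∘ to) (sym (place-coord i p)))
    (trans (eq (coord i w)) (cong (coord j ∘ to) (place-coord i refl)))
    where open Iso ψ
  ... | inj₂ eq = inj₂ λ w p → trans (cong (rest j ∘ to) (sym (place-coord i p)))
    (trans (eq (coord i w)) (cong (rest j ∘ to) (place-coord i refl)))
    where open Iso ψ

  matching-layers : ∀ (ψ : X ≅ X) i j v →
    (∀ w → rest i w ≡ rest i v → rest j (_≅_.to ψ w) ≡ rest j (_≅_.to ψ v)) →
    (∀ u → rest j u ≡ rest j (_≅_.to ψ v) → rest i (_≅_.from ψ u) ≡ rest i v) →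
    F i ≅ F j
  matching-layers ψ i j v image preimage = layer-iso (transfer ψ i j) _ _
    (λ x → image _ (rest-place i x _)) (λ y → preimage _ (rest-place j y _))

  -- Otherwise the layer would be moved into a layer of another factor j, and
  -- that whole layer pulls back into layer i, so that F i ≅ F j.
  layer-preserved : ∀ (ψ : X ≅ X) i v w → rest i w ≡ rest i v →
    rest i (_≅_.to ψ w) ≡ rest i (_≅_.to ψ v)
  layer-preserved ψ i v w p with layer-image ψ i i v
  ... | inj₂ image = image w p
  ... | inj₁ fixed
    with Fin.all? (λ j → Graph._≟_ (F j) (coord j (_≅_.to ψ w)) (coord j (_≅_.to ψ v)))
  ...   | yes eq = cong (rest i) (ext eq)
  ...   | no ¬eq
    with j , wⱼ≢vⱼ ← Fin.¬∀⟶∃¬ n _ (λ j → Graph._≟_ (F j) _ _) ¬eq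
    with layer-image ψ i j v
  ...     | inj₁ eq = contradiction (eq w p) wⱼ≢vⱼ
  ...     | inj₂ image
    with layer-image (≅-sym ψ) j i (_≅_.to ψ v)
  ...       | inj₂ preimage = contradiction
    (matching-layers ψ i j v image
      (λ u q → trans (preimage u q) (cong (rest i) (Iso.from-to ψ v))))
    -- Here `i` and `j` differ: the images of `w` and `v` agree in coordinate `i` by `fixed`, but
    -- not in coordinate `j`.
    (distinct i j λ { refl → wⱼ≢vⱼ (fixed w p) })
  -- If coordinate `i` were constant on the preimage of that layer of `j`, then `w` and `v` would
  -- share coordinate `i` besides the rest, hence coincide.
  ...       | inj₁ eq = contradiction (cong (coord j ∘ to) w≡v) wⱼ≢vⱼ
    where
    open Iso ψ
    same-coord : coord i w ≡ coord i v
    same-coord = trans (cong (coord i) (sym (from-to w)))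
      (trans (eq (to w) (image w p)) (cong (coord i) (from-to v)))
    w≡v : w ≡ v
    w≡v = Iso.to-injective (σ i) (cong₂ _,_ same-coord p)

  -- A walk in `Q i` changes the other coordinates while coordinate `i` stays fixed. Each step lies
  -- in a layer of some `j ≢ i`; `ψ` maps it into a layer of `j`, on which coordinate `i` is
  -- constant.
  coord-determined : ∀ (ψ : X ≅ X) i {v w} → coord i v ≡ coord i w →
    coord i (_≅_.to ψ v) ≡ coord i (_≅_.to ψ w)
  coord-determined ψ i {v} {w} eq = begin
    coord i (to v)                                ≡⟨ cong (coord i ∘ to) (place-coord i refl) ⟨
    coord i (to (place i (coord i v) (rest i v))) ≡⟨ along (proj₂ (Q-connected i) _ _) ⟩
    coord i (to (place i (coord i v) (rest i w))) ≡⟨ cong (λ a → coord i (to (place i a (rest i w)))) eq ⟩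
    coord i (to (place i (coord i w) (rest i w))) ≡⟨ cong (coord i ∘ to) (place-coord i refl) ⟩
    coord i (to w)                                ∎
    where
    open ≡-Reasoning
    open Iso ψ
    step : ∀ {a q q′} → E (Q i) q q′ → coord i (to (place i a q)) ≡ coord i (to (place i a q′))
    step {a} {q} {q′} e with j , p ← edge⇒rest≡ (Iso.from-edge (σ i) (inj₁ (refl {x = a} , e)))
      with i Fin.≟ j
    ... | no i≢j   = indep i≢j (layer-preserved ψ j _ _ p)
    -- With `j = i` the edge `e` of `Q i` would have equal ends.
    ... | yes refl = contradiction
      (E-resp (Q i) (trans (sym (rest-place i a q)) (trans p (rest-place i a q′))) refl e)
      (Graph.E-irr (Q i))
    along : ∀ {a q q′} → Star (E (Q i)) q q′ →
      coord i (to (place i a q)) ≡ coord i (to (place i a q′))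
    along ε       = refl
    along (e ◅ s) = trans (step e) (along s)

  -- `v` picks the layer on which `ψ` is read; by `component-coord` every layer gives the same map.
  component : X ≅ X → V X → ∀ i → F i ≅ F i
  component ψ v i = matching-layers ψ i i v
    (λ w → layer-preserved ψ i v w)
    (λ u p → trans (layer-preserved (≅-sym ψ) i (_≅_.to ψ v) u p)
      (cong (rest i) (Iso.from-to ψ v)))

  component-coord : ∀ ψ v i w → _≅_.to (component ψ v i) (coord i w) ≡ coord i (_≅_.to ψ w)
  component-coord ψ v i w = coord-determined ψ i (coord-place i (coord i w) (rest i v))

-- Colourings and thresholds

-- Classes are numbered by `Fin size` so that `class` is itself a colouring, which by `class-rep`
-- uses all `size` colours.
record Quotient {S : Set} (_∼_ : Rel S 0ℓ) : Set where
  field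
    size       : ℕ
    class      : S → Fin size
    rep        : Fin size → S
    class-cong : ∀ {u v} → u ∼ v → class u ≡ class v
    class-rep  : ∀ i → class (rep i) ≡ i
    rep-class  : ∀ v → rep (class v) ∼ v

quotientFin : ∀ {n} {_∼_ : Rel (Fin n) 0ℓ} → IsDecEquivalence _∼_ → Quotient _∼_
quotientFin {zero} eq = record
  { size = 0 ; class = λ () ; rep = λ () ; class-cong = λ { {()} }
  ; class-rep = λ () ; rep-class = λ () }
quotientFin {suc n} {_∼_} eq
  with quotientFin (On.isDecEquivalence suc eq)
... | R with Fin.any? (λ j → IsDecEquivalence._≟_ eq (suc (Quotient.rep R j)) zero)
...   | yes (j , repⱼ∼0) = record
  { size       = size
  ; class      = λ { zero → j ; (suc i) → class i }
  ; rep        = suc ∘ rep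
  ; class-cong = λ { {zero}  {zero}  _ → refl
                   ; {zero}  {suc i} p → joins p
                   ; {suc i} {zero}  p → sym (joins (∼.sym p))
                   ; {suc i} {suc k} p → class-cong p }
  ; class-rep  = class-rep
  ; rep-class  = λ { zero → repⱼ∼0 ; (suc i) → rep-class i }
  }
  where
  open Quotient R
  module ∼ = IsDecEquivalence eq
  joins : ∀ {i} → zero ∼ suc i → j ≡ class i
  joins p = trans (sym (class-rep j)) (class-cong (∼.trans repⱼ∼0 p))
...   | no new = record
  { size       = suc size
  ; class      = λ { zero → zero ; (suc i) → suc (class i) }
  ; rep        = λ { zero → zero ; (suc j) → suc (rep j) }
  ; class-cong = λ { {zero}  {zero}  _ → refl
                   ; {zero}  {suc i} p → contradiction (_ , ∼.trans (rep-class i) (∼.sym p)) new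
                   ; {suc i} {zero}  p → contradiction (_ , ∼.trans (rep-class i) p) new
                   ; {suc i} {suc k} p → cong suc (class-cong p) }
  ; class-rep  = λ { zero → refl ; (suc j) → cong suc (class-rep j) }
  ; rep-class  = λ { zero → ∼.refl ; (suc i) → rep-class i }
  }
  where
  open Quotient R
  module ∼ = IsDecEquivalence eq

quotientV : ∀ X {_∼_ : Rel (V X) 0ℓ} → IsDecEquivalence _∼_ → Quotient _∼_
quotientV X {_∼_} eq = record
  { size       = size
  ; class      = class ∘ to
  ; rep        = from ∘ rep
  ; class-cong = λ p → class-cong (∼.trans (back _) (∼.trans p (∼.sym (back _))))
  ; class-rep  = λ i → trans (cong class (strictlyInverseˡ _)) (class-rep i)
  ; rep-class  = λ v → ∼.trans (rep-class (to v)) (back v)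
  }
  where
  open Inverse (Graph.enum X) using (to; from; strictlyInverseˡ; strictlyInverseʳ)
  module ∼ = IsDecEquivalence eq
  open Quotient (quotientFin (On.isDecEquivalence from eq))
  back : ∀ v → from (to v) ∼ v
  back v = ∼.reflexive (strictlyInverseʳ v)

-- The classes unite the vertices of A over which the same colours occur.
module _ {A B : Graph} {k} (c : V (A □ B) → Fin k) where

  private
    vertexB : Fin ∣ B ∣ → V B
    vertexB = Inverse.from (Graph.enum B)

    Occurs : V A → Fin k → Set
    Occurs a y = ∃ λ i → c (a , vertexB i) ≡ y

    occurs : ∀ {a b y} → c (a , b) ≡ y → Occurs a y
    occurs eq = Inverse.to (Graph.enum B) _ ,
      trans (cong (λ b → c (_ , b)) (Inverse.strictlyInverseʳ (Graph.enum B) _)) eq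

    _∼_ : Rel (V A) 0ℓ
    u ∼ v = ∀ y → (Occurs u y → Occurs v y) × (Occurs v y → Occurs u y)

    Occurs? : ∀ a y → Dec (Occurs a y)
    Occurs? a y = Fin.any? λ i → c (a , vertexB i) Fin.≟ y

    ∼-isDecEquivalence : IsDecEquivalence _∼_
    ∼-isDecEquivalence = record
      { isEquivalence = record
        { refl  = λ y → id , id
        ; sym   = λ p y → proj₂ (p y) , proj₁ (p y)
        ; trans = λ p q y → proj₁ (q y) ∘ proj₁ (p y) , proj₂ (p y) ∘ proj₂ (q y)
        }
      ; _≟_ = λ u v → Fin.all? λ y →
          (Occurs? u y →-dec Occurs? v y) ×-dec (Occurs? v y →-dec Occurs? u y)
      }

    open Quotient (quotientV A ∼-isDecEquivalence)

    -- A colour is recovered from the class of a vertex over which it occurs, together with a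
    -- position where it occurs over the representative of that class.
    colours≤ : StrictlySurjective _≡_ c → k ≤ size * ∣ B ∣
    colours≤ surj = Fin.injective⇒≤ {f = λ y → combine (proj₁ (code y)) (proj₁ (proj₂ (code y)))}
      λ {y} {z} eq → let eq₁ , eq₂ = Fin.combine-injective _ _ _ _ eq in
        trans (sym (proj₂ (proj₂ (code y))))
          (trans (cong₂ (λ j i → c (rep j , vertexB i)) eq₁ eq₂) (proj₂ (proj₂ (code z))))
      where
      code : ∀ y → ∃ λ j → Occurs (rep j) y
      code y = let (a , b) , eq = surj y in class a , proj₂ (rep-class a y) (occurs eq)

  -- By `over`, `ψ` carries the vertices over `a` onto those over the image of `a` under `φ`. The
  -- same colours occur over both, so `φ` preserves `class`.
  component-trivial : ∀ {t} → IsThreshold A t → (t ∸ 1) * ∣ B ∣ < k → StrictlySurjective _≡_ c →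
    (φ : A ≅ A) (ψ : A □ B ≅ A □ B) → (∀ v → c (_≅_.to ψ v) ≡ c v) →
    (∀ v → proj₁ (_≅_.to ψ v) ≡ _≅_.to φ (proj₁ v)) → ∀ a → _≅_.to φ a ≡ a
  component-trivial {t} isθ bound surj φ ψ preserves over with t ℕ.≤? size
  ... | yes t≤size = IsThreshold.bound isθ size t≤size class (λ i → rep i , class-rep i) φ
    (λ a → class-cong (λ y → shrink a y , grow a y))
    where
    grow : ∀ a y → Occurs a y → Occurs (_≅_.to φ a) y
    grow a y (i , eq) = occurs (trans
      (cong (λ x → c (x , proj₂ (_≅_.to ψ (a , vertexB i)))) (sym (over _)))
      (trans (preserves _) eq))
    shrink : ∀ a y → Occurs (_≅_.to φ a) y → Occurs a y
    shrink a y (i , eq) = occurs {b = proj₂ v} (trans (cong (λ x → c (x , proj₂ v)) a≡) (trans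
      (sym (preserves v)) (trans (cong c (Iso.to-from ψ _)) eq)))
      where
      v : V (A □ B)
      v = _≅_.from ψ (_≅_.to φ a , vertexB i)
      -- As `φ` is injective, the `ψ`-preimage of a vertex over the image of `a` lies over `a`.
      a≡ : a ≡ proj₁ v
      a≡ = Iso.to-injective φ (trans (sym (cong proj₁ (Iso.to-from ψ _))) (over v))
  -- Fewer than `t` classes means `size` at most `t ∸ 1`, and `colours≤` then contradicts `bound`.
  ... | no t≰size = contradiction bound (ℕ.≤⇒≯ (ℕ.≤-trans (colours≤ surj)
    (ℕ.*-monoˡ-≤ ∣ B ∣ (ℕ.∸-monoˡ-≤ 1 (ℕ.≰⇒> t≰size)))))

-- Comparing a product with its factors.

AllDistinguishing-resp : ∀ {k} → X ≅ Y → AllDistinguishing X k → AllDistinguishing Y k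
AllDistinguishing-resp {X} {Y} σ d c surj φ preserves y =
  to-from-≡ (d (c ∘ to) (λ i → from (proj₁ (surj i)) ,
      trans (cong c (to-from _)) (proj₂ (surj i)))
    (≅-trans σ (≅-trans φ (≅-sym σ)))
    (λ x → trans (cong c (to-from _)) (preserves (to x))) (from y))
  where
  open Iso σ
  to-from-≡ : from (_≅_.to φ (to (from y))) ≡ from y → _≅_.to φ y ≡ y
  to-from-≡ eq = Iso.to-injective (≅-sym σ)
    (trans (cong (from ∘ _≅_.to φ) (sym (to-from y))) eq)

-- Colouring `(x , y)` by the pair of `c x` and `y` uses all `k * ∣ B ∣` colours and is preserved by
-- `φ` acting on the first coordinate. That map is therefore the identity, which is read off at `b`.
AllDistinguishing-factor : ∀ {k} → V B →
  AllDistinguishing (A □ B) (k * ∣ B ∣) → AllDistinguishing A k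
AllDistinguishing-factor {B} {A} {k} b d c surj φ preserves a = cong proj₁
  (d (λ (x , y) → combine (c x) (Inverse.to (Graph.enum B) y)) pair-surj
    (≅-trans □-comm (≅-trans (□-congʳ φ) □-comm))
    (λ (x , y) → cong (λ i → combine i _) (preserves x)) (a , b))
  where
  pair-surj : StrictlySurjective _≡_ λ ((x , y) : V (A □ B)) →
    combine (c x) (Inverse.to (Graph.enum B) y)
  pair-surj i = let j , l = remQuot ∣ B ∣ i ; x , eq = surj j in
    (x , Inverse.from (Graph.enum B) l) ,
    trans (cong₂ combine eq (Inverse.strictlyInverseˡ (Graph.enum B) l))
      (Fin.combine-remQuot {k} ∣ B ∣ i)

-- Otherwise `k * ∣ B ∣` would reach `s` for every `k ≥ t ∸ 1`, and `t ∸ 1` would already bound the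
-- colourings of `A`, against minimality.
threshold-factor : ∀ {s t} → X ≅ A □ B → V B → IsThreshold X s → IsThreshold A t →
  (t ∸ 1) * ∣ B ∣ < s
threshold-factor {t = zero}  σ b isθX isθA = contradiction (IsThreshold.positive isθA) λ ()
-- Minimality speaks only of positive numbers and cannot be applied to `t ∸ 1 = 0`; but then the
-- left side is 0 and `s` is positive.
threshold-factor {t = suc zero} σ b isθX isθA = IsThreshold.positive isθX
threshold-factor {B = B} {s = s} {t = suc (suc t)} σ b isθX isθA with s ℕ.≤? suc t * ∣ B ∣
... | no  s≰ = ℕ.≰⇒> s≰
... | yes s≤ = contradiction
  (IsThreshold.minimal isθA (suc t) (s≤s z≤n) λ k t<k →
    AllDistinguishing-factor b (AllDistinguishing-resp σ
      (IsThreshold.bound isθX _ (ℕ.≤-trans s≤ (ℕ.*-monoˡ-≤ ∣ B ∣ t<k)))))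
  (ℕ.<⇒≱ ℕ.≤-refl)

-- The maximum and the formula for the threshold.

≤-foldr-⊔ : ∀ {n} (f : Vector ℕ n) i → f i ≤ foldr _⊔_ 0 f
≤-foldr-⊔ f zero    = ℕ.m≤m⊔n _ _
≤-foldr-⊔ f (suc i) = ℕ.≤-trans (≤-foldr-⊔ (tail f) i) (ℕ.m≤n⊔m _ _)

-- `0 < b` accounts for the initial value 0 of the fold.
foldr-⊔-< : ∀ {n b} (f : Vector ℕ n) → 0 < b → (∀ i → f i < b) → foldr _⊔_ 0 f < b
foldr-⊔-< {zero}  f 0<b f< = 0<b
foldr-⊔-< {suc n} f 0<b f< = ℕ.⊔-lub (f< zero) (foldr-⊔-< (tail f) 0<b (f< ∘ suc))

theorem4p1 : (m : ℕ) (G : Graph) (F : Vector Graph (2 + m)) →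
    G ≅ ∏ F →
    (∀ i → IsPrime (F i)) →
    (∀ i → Connected (F i)) →
    (∀ i j → i ≢ j → ¬ (F i ≅ F j)) →
    θ G ≡ foldr _⊔_ 0 (λ i → (θ (F i) ∸ 1) * ∣ ∏ (removeAt F i) ∣) + 1
theorem4p1 m G F iso prime connected distinct =
  ℕ.≤-antisym (IsThreshold.minimal θG (M + 1) (ℕ.m≤n+m 1 M) distinguishing)
    (subst (_≤ θ G) (ℕ.+-comm 1 M) (foldr-⊔-< bounds (IsThreshold.positive θG) lower))
  where
  Q : Vector Graph (2 + m)
  Q i = ∏ (removeAt F i)

  bounds : Vector ℕ (2 + m)
  bounds i = (θ (F i) ∸ 1) * ∣ Q i ∣

  M : ℕ
  M = foldr _⊔_ 0 bounds

  θG : IsThreshold G (θ G)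
  θG = proj₂ (threshold G)

  Q-connected : ∀ i → Connected (Q i)
  Q-connected i = ∏-connected (removeAt F i) (connected ∘ punchIn i)

  coords : Coordinates G F Q
  coords = record
    { σ     = λ i → ≅-trans iso (isolate F i)
    ; ext   = Iso.to-injective iso ∘ isolate-ext F
    ; indep = λ i≢j → isolate-indep F i≢j
    }

  open Coordinates coords
  open Automorphisms coords prime connected Q-connected distinct

  lower : ∀ i → bounds i < θ G
  lower i = threshold-factor (σ i) (proj₁ (Q-connected i)) θG (proj₂ (threshold (F i)))

  distinguishing : ∀ k → M + 1 ≤ k → AllDistinguishing G k
  -- It is enough that `ψ` fixes each coordinate of `v`. For coordinate `i`, `c` and `ψ` are carried
  -- along `σ i` to `F i □ Q i`, where the component of `ψ` is trivial because `k` exceeds `M`,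
  -- hence `bounds i`.
  distinguishing k M<k c surj ψ preserves v = ext λ i →
    trans (sym (component-coord ψ v i v))
      (component-trivial (c ∘ _≅_.from (σ i)) (proj₂ (threshold (F i)))
        (ℕ.≤-trans (s≤s (≤-foldr-⊔ bounds i)) (subst (_≤ k) (ℕ.+-comm M 1) M<k))
        (λ y → _≅_.to (σ i) (proj₁ (surj y)) ,
          trans (cong c (Iso.from-to (σ i) _)) (proj₂ (surj y)))
        (component ψ v i) (≅-trans (≅-sym (σ i)) (≅-trans ψ (σ i)))
        (λ x → trans (cong c (Iso.from-to (σ i) _)) (preserves _))
        (λ x → trans (sym (component-coord ψ v i _))
          (cong (_≅_.to (component ψ v i) ∘ proj₁) (Iso.to-from (σ i) x)))
        (coord i v))
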